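{- Let the set of actions $A$ be partitioned into $A^r=\{a\}$ and $A^l=\{b\}$, with no bivariant actions. Then there is no translation $\mathcal{T}$ from LTSs modulo $\lesssim_{cc}$ into LTSs modulo $\lesssim_B$ (i.e. no map $\mathcal{T}$ sending processes over $A$ to processes over some set of actions with bisimulation set $B$) satisfying all of the following conditions: (1) for all $p$ and $q$, $p\lesssim_{cc}q$ if and only if $\mathcal{T}(p)\lesssim_B\mathcal{T}(q)$; (2) $\mathcal{T}$ is a homomorphism with respect to $+$, that is, $\mathcal{T}(p+q)=\mathcal{T}(p)+\mathcal{T}(q)$ for all $p,q$; (3) there is an $n$ such that $\mathcal{T}(b^n)$ is not simulation equivalent to $\mathcal{T}(0)$.
   Context: A process is an LTS (a set of states with a transition relation labelled by actions) with a distinguished state; it is identified notationally with that state $p$. $0$ is the process with no transitions; $b^n$ is the process consisting of $n$ consecutive $b$-labelled transitions; $p+q$ is the standard nondeterministic composition from CCS, whose transitions from its distinguished state are those of $p$ together with those of $q$ ($p+q\xrightarrow{c}r$ iff $p\xrightarrow{c}r$ or $q\xrightarrow{c}r$). For a signature $(A^r,A^l)$ without bivariant actions, $p\lesssim_{cc}q$ iff $p\,R\,q$ for some relation $R$ such that whenever $p\,R\,q$: for all $c\in A^r$ and $p\xrightarrow{c}p'$ there is $q\xrightarrow{c}q'$ with $p'\,R\,q'$; and for all $c\in A^l$ and $q\xrightarrow{c}q'$ there is $p\xrightarrow{c}p'$ with $p'\,R\,q'$. For a subset $B$ of the set of actions (the bisimulation set), $p\lesssim_B q$ iff $p\,R\,q$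 for some relation $R$ such that whenever $p\,R\,q$: for every action $c$, if $p\xrightarrow{c}p'$ then there is $q\xrightarrow{c}q'$ with $p'\,R\,q'$; and for all $c\in B$, if $q\xrightarrow{c}q'$ then there is $p\xrightarrow{c}p'$ with $p'\,R\,q'$. The simulation preorder is $\lesssim_\emptyset$, and two processes are simulation equivalent if each is below the other in the simulation preorder. -}

module Defs where

open import Level using (Level; _⊔_; Lift; lift) renaming (suc to lsuc)
open import Data.Nat using (ℕ; suc)
open import Data.Fin using (Fin; zero; toℕ)
open import Data.Product using (_×_; Σ-syntax; ∃-syntax)
open import Data.Empty.Polymorphic using (⊥)
open import Data.Unit.Polymorphic using (⊤; tt)
open import Relation.Binary.Core using (REL)
open import Relation.Binary.PropositionalEquality using (_≡_)
open import Relation.Unary using (Pred; _∈_; ∅; ｛_｝)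

private
  variable
    α β ρ ℓ : Level

record LTS (A : Set α) (ℓ : Level) : Set (α ⊔ lsuc ℓ) where
  field
    State : Set ℓ
    _-[_]→_ : State → A → State → Set ℓ

record Process (A : Set α) (ℓ : Level) : Set (α ⊔ lsuc ℓ) where
  constructor process
  field
    lts  : LTS A ℓ
    root : LTS.State lts
  open LTS lts public

open Process using (State; root)

𝟎 : {A : Set α} → Process A ℓ
𝟎 = process (record { State = ⊤ ; _-[_]→_ = λ _ _ _ → ⊥ }) tt

data SumState (P Q : Set ℓ) : Set ℓ where
  start : SumState P Q
  left  : P → SumState P Q
  right : Q → SumState P Q

-- The root is fresh: reusing a root of p or q would be wrong when that root
-- has incoming transitions.
infixl 6 _+_

_+_ : {A : Set α} → Process A ℓ → Process A ℓ → Process A ℓ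
_+_ {ℓ = ℓ} {A = A} p q =
  process (record { State = SumState P.State Q.State ; _-[_]→_ = step }) start
  where
  module P = Process p
  module Q = Process q

  step : SumState P.State Q.State → A → SumState P.State Q.State → Set ℓ
  step start     c (left p′)  = P.root P.-[ c ]→ p′
  step start     c (right q′) = Q.root Q.-[ c ]→ q′
  step (left p)  c (left p′)  = p P.-[ c ]→ p′
  step (right q) c (right q′) = q Q.-[ c ]→ q′
  step _         _ _          = ⊥

data Action : Set where
  a b : Action

b^_ : ℕ → Process Action ℓ
b^_ {ℓ} n = process (record { State = Lift ℓ (Fin (suc n)) ; _-[_]→_ = step }) (lift zero)
  where
  step : Lift ℓ (Fin (suc n)) → Action → Lift ℓ (Fin (suc n)) → Set ℓ
  step (lift i) c (lift j) = Lift ℓ (c ≡ b × toℕ j ≡ suc (toℕ i))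

module _ {A : Set α} (p q : Process A ℓ) where
  private
    module P = Process p
    module Q = Process q

  record IsCCSimulation (Aʳ Aˡ : Pred A ρ) (R : REL P.State Q.State ℓ) : Set (α ⊔ ρ ⊔ ℓ) where
    field
      forth : ∀ {s t} → R s t → ∀ {c s′} → c ∈ Aʳ → s P.-[ c ]→ s′ →
              ∃[ t′ ] (t Q.-[ c ]→ t′ × R s′ t′)
      back  : ∀ {s t} → R s t → ∀ {c t′} → c ∈ Aˡ → t Q.-[ c ]→ t′ →
              ∃[ s′ ] (s P.-[ c ]→ s′ × R s′ t′)

  record IsPartialBisimulation (B : Pred A ρ) (R : REL P.State Q.State ℓ) : Set (α ⊔ ρ ⊔ ℓ) where
    field
      forth : ∀ {s t} → R s t → ∀ {c s′} → s P.-[ c ]→ s′ →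
              ∃[ t′ ] (t Q.-[ c ]→ t′ × R s′ t′)
      back  : ∀ {s t} → R s t → ∀ {c t′} → c ∈ B → t Q.-[ c ]→ t′ →
              ∃[ s′ ] (s P.-[ c ]→ s′ × R s′ t′)

CCSim : {A : Set α} (Aʳ Aˡ : Pred A ρ) → Process A ℓ → Process A ℓ → Set (α ⊔ ρ ⊔ lsuc ℓ)
CCSim {ℓ = ℓ} Aʳ Aˡ p q =
  Σ[ R ∈ REL (State p) (State q) ℓ ] (IsCCSimulation p q Aʳ Aˡ R × R (root p) (root q))

infix 4 _≲cc_ _≲[_]_ _≈[_]_ _≈ₛ_

_≲cc_ : Process Action ℓ → Process Action ℓ → Set (lsuc ℓ)
_≲cc_ = CCSim ｛ a ｝ ｛ b ｝

_≲[_]_ : {A : Set α} → Process A ℓ → Pred A ρ → Process A ℓ → Set (α ⊔ ρ ⊔ lsuc ℓ)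
_≲[_]_ {ℓ = ℓ} p B q =
  Σ[ R ∈ REL (State p) (State q) ℓ ] (IsPartialBisimulation p q B R × R (root p) (root q))

-- Equality of "LTSs modulo ≲[ B ]": the equivalence induced by the preorder.
_≈[_]_ : {A : Set α} → Process A ℓ → Pred A ρ → Process A ℓ → Set (α ⊔ ρ ⊔ lsuc ℓ)
p ≈[ B ] q = p ≲[ B ] q × q ≲[ B ] p

_≈ₛ_ : {A : Set α} → Process A ℓ → Process A ℓ → Set (α ⊔ lsuc ℓ)
p ≈ₛ q = p ≲[ ∅ ] q × q ≲[ ∅ ] p

{-# OPTIONS --safe #-}
-- Since p + 0 ≲cc p, we have 𝒯 p + 𝒯 0 ≲_B 𝒯 p. A summand is simulated by the
-- sum, so 𝒯 0 is simulated by 𝒯 p for every p. Conversely b is purely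
-- contravariant, so bⁿ ≲cc 0, and hence 𝒯 (bⁿ) is simulated by 𝒯 0.
module Submission where

open import Defs
open import Level using (Level; lift)
open import Data.Nat using (ℕ)
open import Data.Product using (_×_; _,_; proj₂; Σ-syntax; ∃-syntax)
open import Data.Empty.Polymorphic using (⊥)
open import Data.Unit.Polymorphic using (⊤; tt)
open import Function.Bundles using (_⇔_; Equivalence)
open import Relation.Binary.Core using (REL)
open import Relation.Binary.PropositionalEquality using (_≡_; refl)
open import Relation.Nullary using (¬_)
open import Relation.Unary using (Pred; ∅; _⊆_)

open Process using (State; root)
open IsPartialBisimulation

private
  variable
    α β γ ℓ : Level
    A : Set α
    p q r : Process A ℓ

≲-trans : {B : Pred A β} → p ≲[ B ] q → q ≲[ B ] r → p ≲[ B ] r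
≲-trans {p = p} {q = q} {r = r} {B = B} (R , R-bisim , Rpq) (S , S-bisim , Sqr) =
  RS , RS-bisim , (root q , Rpq , Sqr)
  where
  RS : REL (State p) (State r) _
  RS s u = ∃[ t ] (R s t × S t u)

  RS-bisim : IsPartialBisimulation p r B RS
  RS-bisim .forth (_ , Rst , Stu) s→s′ =
    let t′ , t→t′ , Rs′t′ = R-bisim .forth Rst s→s′
        u′ , u→u′ , St′u′ = S-bisim .forth Stu t→t′
    in u′ , u→u′ , (t′ , Rs′t′ , St′u′)
  RS-bisim .back (_ , Rst , Stu) c∈B u→u′ =
    let t′ , t→t′ , St′u′ = S-bisim .back Stu c∈B u→u′
        s′ , s→s′ , Rs′t′ = R-bisim .back Rst c∈B t→t′
    in s′ , s→s′ , (t′ , Rs′t′ , St′u′)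

≲-antitone : {B : Pred A β} {C : Pred A γ} → C ⊆ B → p ≲[ B ] q → p ≲[ C ] q
≲-antitone C⊆B (R , R-bisim , Rpq) =
  R , record { forth = R-bisim .forth
             ; back  = λ Rst c∈C → R-bisim .back Rst (C⊆B c∈C) } , Rpq

-- The sum may also move as `p`, which `q` need not match, so a backward clause could fail; hence
-- the empty bisimulation set.
≲∅-+ʳ : (p q : Process A ℓ) → q ≲[ ∅ ] (p + q)
≲∅-+ʳ p q = R , record { forth = λ {s} {t} → R-forth s t ; back = λ _ () } , refl
  where
  R : REL (State q) (State (p + q)) _
  -- `start` is never re-entered: if `q` returns to its root, the sum is then in `right (root q)`,
  -- which the last clause covers.
  R s start     = s ≡ root q
  R s (left _)  = ⊥
  R s (right t) = s ≡ t

  R-forth : ∀ s t → R s t → ∀ {c s′} → Process._-[_]→_ q s c s′ →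
            ∃[ t′ ] (Process._-[_]→_ (p + q) t c t′ × R s′ t′)
  R-forth s start     refl s→s′ = right _ , s→s′ , refl
  R-forth s (right _) refl s→s′ = right _ , s→s′ , refl

-- Folding `start` and `left (root p)` onto `root p` gives a bisimulation, so both clauses hold for
-- every action.
+-𝟎-≲cc : (p : Process Action ℓ) → p + 𝟎 ≲cc p
+-𝟎-≲cc p = R , record { forth = λ {s} {t} Rst {c} {s′} _ → R-forth s t Rst s′
                       ; back  = λ {s} {t} Rst _ → R-back s t Rst } , refl
  where
  R : REL (State (p + 𝟎)) (State p) _
  R start     t = root p ≡ t
  R (left s)  t = s ≡ t
  -- The copy of `𝟎` is never entered, since its root has no transitions.
  R (right _) t = ⊥

  R-forth : ∀ s t → R s t → ∀ {c} s′ → Process._-[_]→_ (p + 𝟎) s c s′ →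
            ∃[ t′ ] (Process._-[_]→_ p t c t′ × R s′ t′)
  R-forth start    _ refl (left s′) s→s′ = s′ , s→s′ , refl
  R-forth (left _) _ refl (left s′) s→s′ = s′ , s→s′ , refl

  R-back : ∀ s t → R s t → ∀ {c t′} → Process._-[_]→_ p t c t′ →
           ∃[ s′ ] (Process._-[_]→_ (p + 𝟎) s c s′ × R s′ t′)
  R-back start    _ refl t→t′ = left _ , t→t′ , refl
  R-back (left _) _ refl t→t′ = left _ , t→t′ , refl

-- Both clauses are vacuous, so the full relation works: `b^ n` never performs `a`, and `𝟎` has no
-- `b` to be answered.
b^-≲cc-𝟎 : (n : ℕ) → _≲cc_ {ℓ} (b^ n) 𝟎
b^-≲cc-𝟎 n = (λ _ _ → ⊤)
           , record { forth = λ { _ refl (lift (() , _)) } ; back = λ { _ _ (lift ()) } }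
           , tt

mainTheorem10 : {ℓ ℓ′ α β : Level} (A′ : Set α) (B : Pred A′ β) →
    ¬ (Σ[ 𝒯 ∈ (Process Action ℓ → Process A′ ℓ′) ]
    ( (∀ p q → (p ≲cc q) ⇔ (𝒯 p ≲[ B ] 𝒯 q))
    × (∀ p q → 𝒯 (p + q) ≈[ B ] (𝒯 p + 𝒯 q))
    × (∃[ n ] (¬ (𝒯 (b^ n) ≈ₛ 𝒯 𝟎)))))
mainTheorem10 A′ B (𝒯 , 𝒯-≲ , 𝒯-+ , n , 𝒯bⁿ≉𝒯𝟎) = 𝒯bⁿ≉𝒯𝟎 (𝒯bⁿ≲𝒯𝟎 , 𝒯𝟎≲𝒯bⁿ)
  where
  𝒯bⁿ≲𝒯𝟎 : 𝒯 (b^ n) ≲[ ∅ ] 𝒯 𝟎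
  𝒯bⁿ≲𝒯𝟎 = ≲-antitone (λ ()) (Equivalence.to (𝒯-≲ (b^ n) 𝟎) (b^-≲cc-𝟎 n))

  𝒯bⁿ+𝒯𝟎≲𝒯bⁿ : 𝒯 (b^ n) + 𝒯 𝟎 ≲[ B ] 𝒯 (b^ n)
  -- `proj₂` goes from `𝒯 (b^ n) + 𝒯 𝟎` to `𝒯 (b^ n + 𝟎)`; monotonicity of `𝒯` then absorbs `𝟎`
  -- inside its argument.
  𝒯bⁿ+𝒯𝟎≲𝒯bⁿ = ≲-trans (proj₂ (𝒯-+ (b^ n) 𝟎))
                        (Equivalence.to (𝒯-≲ (b^ n + 𝟎) (b^ n)) (+-𝟎-≲cc (b^ n)))

  𝒯𝟎≲𝒯bⁿ : 𝒯 𝟎 ≲[ ∅ ] 𝒯 (b^ n)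
  -- The summand lies below the sum only for plain simulation, so `B` is weakened to `∅` before
  -- composing.
  𝒯𝟎≲𝒯bⁿ = ≲-trans (≲∅-+ʳ (𝒯 (b^ n)) (𝒯 𝟎)) (≲-antitone (λ ()) 𝒯bⁿ+𝒯𝟎≲𝒯bⁿ)
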